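{- Let $T$ be a theory. (1) The following are equivalent: $T$ is unstable; $T$ trace defines $(\mathbb{Q};<)$; $T$ trace defines some infinite linear order. (2) The following are equivalent: $T$ is $\mathrm{IP}$ (has the independence property); $T$ trace defines the Erdős-Rado graph; $T$ trace defines the generic binary relation.
   Context: Conventions: structures and theories are first order; theories are complete, consistent and deductively closed; "definable" means definable with parameters. A trace definition of a structure $\mathcal{M}$ in a structure $\mathcal{N}$ is a map $\tau\colon M\to N^n$ (some $n\ge 1$) such that for every $m\ge 1$ and every $\mathcal{M}$-definable $X\subseteq M^m$ there is an $\mathcal{N}$-definable $Y\subseteq N^{mn}$ with $X=\{(a_1,\dots,a_m)\in M^m : (\tau(a_1),\dots,\tau(a_m))\in Y\}$ (such a $\tau$ is automatically injective). $\mathcal{N}$ trace defines $\mathcal{M}$ if such a $\tau$ exists. A theory $T$ trace defines $\mathcal{M}$ if some model of $T$ trace defines $\mathcal{M}$. The Erdős-Rado graph is the Fraïssé limit of the class of finite graphs; the generic binary relation is the Fraïssé limit of the class of all finite sets equipped with a binary relation. -}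

module Defs where

open import Data.Empty using (⊥)
open import Data.Fin using (Fin)
open import Data.Nat using (ℕ; suc; _+_; _*_; _<_; NonZero)
open import Data.Product using (Σ; ∃; _×_; _,_)
open import Data.Rational as ℚ using (ℚ)
open import Data.Sum using (_⊎_)
open import Data.Vec using (Vec; []; _∷_; _++_; lookup; map; concat)
open import Function using (_⇔_; _↔_; _↣_; Injective; StrictlySurjective)
open import Level using (Level; 0ℓ; _⊔_) renaming (suc to lsuc)
open import Relation.Binary using (Rel; IsStrictTotalOrder; Symmetric; Irreflexive)
open import Relation.Binary.PropositionalEquality using (_≡_)
open import Relation.Nullary using (¬_)
open import Relation.Unary using (Pred; Satisfiable; _∈_; _≐_)

private
  variable
    a b ℓ : Level

-- Zermelo's form of the axiom of choice: every set has a choice function on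
-- its inhabited subsets. The last clause, which makes the choice depend only
-- on the extension of a subset, carries the content: without it the statement
-- is trivial, since a proof of Satisfiable P already contains a witness.
AxiomOfChoice : ∀ a → Set (lsuc a)
AxiomOfChoice a =
  (A : Set a) →
  Σ ((P : Pred A a) → Satisfiable P → A) λ choose →
    (∀ P (s : Satisfiable P) → choose P s ∈ P) ×
    (∀ P Q (s : Satisfiable P) (t : Satisfiable Q) →
      P ≐ Q → choose P s ≡ choose Q t)

record Language (a : Level) : Set (lsuc a) where
  field
    Function : ℕ → Set a
    Relation : ℕ → Set a

open Language public

-- As is conventional in first-order logic, structures are nonempty.
record Structure (L : Language a) (ℓ : Level) : Set (a ⊔ lsuc ℓ) where
  field
    Carrier  : Set ℓ
    nonempty : Carrier
    fun      : ∀ {k} → Function L k → Vec Carrier k → Carrier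
    rel      : ∀ {k} → Relation L k → Pred (Vec Carrier k) ℓ

open Structure public

module _ (L : Language a) where

  data Term (n : ℕ) : Set a where
    var  : Fin n → Term n
    func : ∀ {k} → Function L k → Vec (Term n) k → Term n

  -- Formula n consists of the formulas in the free variables 0, …, n - 1;
  -- ex binds variable 0 (de Bruijn). The omitted connectives and ∀ are
  -- classically definable from these.
  data Formula (n : ℕ) : Set a where
    eq   : Term n → Term n → Formula n
    atom : ∀ {k} → Relation L k → Vec (Term n) k → Formula n
    not  : Formula n → Formula n
    and  : Formula n → Formula n → Formula n
    ex   : Formula (suc n) → Formula n

  Sentence : Set a
  Sentence = Formula 0

module _ {L : Language a} (M : Structure L ℓ) where

  mutual
    ⟦_⟧ : ∀ {n} → Term L n → Vec (Carrier M) n → Carrier M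
    ⟦ var i ⟧     v = lookup v i
    ⟦ func f ts ⟧ v = fun M f (⟦ ts ⟧* v)

    ⟦_⟧* : ∀ {n k} → Vec (Term L n) k → Vec (Carrier M) n → Vec (Carrier M) k
    ⟦ [] ⟧*     v = []
    ⟦ t ∷ ts ⟧* v = ⟦ t ⟧ v ∷ ⟦ ts ⟧* v

  Satisfies : ∀ {n} → Formula L n → Pred (Vec (Carrier M) n) ℓ
  Satisfies (eq s t)    v = ⟦ s ⟧ v ≡ ⟦ t ⟧ v
  Satisfies (atom r ts) v = rel M r (⟦ ts ⟧* v)
  Satisfies (not φ)     v = ¬ Satisfies φ v
  Satisfies (and φ ψ)   v = Satisfies φ v × Satisfies ψ v
  Satisfies (ex φ)      v = ∃ λ x → Satisfies φ (x ∷ v)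

  infix 4 _⊨_
  _⊨_ : Sentence L → Set ℓ
  _⊨_ σ = Satisfies σ []

  -- The vector c lists the parameters.
  Definable : ∀ {m} → Pred (Vec (Carrier M) m) ℓ → Set (a ⊔ ℓ)
  Definable {m} X =
    ∃ λ k → Σ (Formula L (m + k)) λ φ → Σ (Vec (Carrier M) k) λ c →
      ∀ v → v ∈ X ⇔ Satisfies φ (v ++ c)

Models : {L : Language a} → Structure L ℓ → Pred (Sentence L) b → Set (a ⊔ b ⊔ ℓ)
Models M Γ = ∀ σ → σ ∈ Γ → M ⊨ σ

record Theory (L : Language ℓ) : Set (lsuc ℓ) where
  field
    theorems   : Pred (Sentence L) ℓ
    complete   : ∀ σ → σ ∈ theorems ⊎ not σ ∈ theorems
    consistent : ∀ σ → ¬ (σ ∈ theorems × not σ ∈ theorems)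
    closed     : ∀ σ → (∀ (M : Structure L ℓ) → Models M theorems → M ⊨ σ) →
                 σ ∈ theorems

open Theory public

module _ {L : Language ℓ} (T : Theory L) where

  Unstable : Set (lsuc ℓ)
  Unstable =
    ∃ λ p → ∃ λ q → Σ (Formula L (p + q)) λ φ →
    Σ (Structure L ℓ) λ N → Models N (theorems T) ×
    Σ (ℕ → Vec (Carrier N) p) λ x → Σ (ℕ → Vec (Carrier N) q) λ y →
      ∀ i j → Satisfies N φ (x i ++ y j) ⇔ i < j

  IP : Set (lsuc ℓ)
  IP =
    ∃ λ p → ∃ λ q → Σ (Formula L (p + q)) λ φ →
    Σ (Structure L ℓ) λ N → Models N (theorems T) ×
    Σ (ℕ → Vec (Carrier N) p) λ x → Σ (Pred ℕ 0ℓ → Vec (Carrier N) q) λ y →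
      ∀ i I → Satisfies N φ (x i ++ y I) ⇔ i ∈ I

module _ {L : Language a} {L′ : Language b} {ℓ ℓ′ : Level} where

  IsTraceDefinition : (M : Structure L ℓ) (N : Structure L′ ℓ′) {n : ℕ} →
                      (Carrier M → Vec (Carrier N) n) →
                      Set (a ⊔ b ⊔ lsuc ℓ ⊔ lsuc ℓ′)
  IsTraceDefinition M N {n} τ =
    ∀ m .{{_ : NonZero m}} (X : Pred (Vec (Carrier M) m) ℓ) → Definable M X →
    Σ (Pred (Vec (Carrier N) (m * n)) ℓ′) λ Y → Definable N Y ×
      (∀ v → v ∈ X ⇔ concat (map τ v) ∈ Y)

  StructureTraceDefines : Structure L′ ℓ′ → Structure L ℓ →
                          Set (a ⊔ b ⊔ lsuc ℓ ⊔ lsuc ℓ′)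
  StructureTraceDefines N M =
    ∃ λ n → NonZero n × Σ (Carrier M → Vec (Carrier N) n) (IsTraceDefinition M N)

infix 4 _TraceDefines_
_TraceDefines_ : {L : Language ℓ} {L′ : Language a} →
                 Theory L → Structure L′ b → Set (a ⊔ lsuc b ⊔ lsuc ℓ)
_TraceDefines_ {ℓ = ℓ} {L = L} T M =
  Σ (Structure L ℓ) λ N → Models N (theorems T) × StructureTraceDefines N M

Finite : Set a → Set a
Finite A = ∃ λ n → A ↔ Fin n

record Embedding {L : Language a} {ℓ ℓ′ : Level}
                 (M : Structure L ℓ) (N : Structure L ℓ′) : Set (a ⊔ ℓ ⊔ ℓ′) where
  field
    to        : Carrier M → Carrier N
    injective : Injective _≡_ _≡_ to
    onFun     : ∀ {k} (f : Function L k) v → to (fun M f v) ≡ fun N f (map to v)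
    onRel     : ∀ {k} (r : Relation L k) v → rel M r v ⇔ rel N r (map to v)

open Embedding public

-- M is the Fraïssé limit of the class K of finite L-structures: it is
-- countable, its age is K, and every isomorphism between finite substructures
-- (given as two embeddings f, g of one finite structure) extends to an
-- automorphism. This is the notion for L without function symbols, where
-- finitely generated substructures are exactly finite ones.
record IsFraisseLimit {L : Language 0ℓ} (K : Pred (Structure L 0ℓ) 0ℓ)
                      (M : Structure L 0ℓ) : Set₁ where
  field
    countable   : Carrier M ↣ ℕ
    age         : ∀ A → A ∈ K ⇔ (Finite (Carrier A) × Embedding A M)
    homogeneous : ∀ A → Finite (Carrier A) → (f g : Embedding A M) →
                  Σ (Embedding M M) λ σ → StrictlySurjective _≡_ (to σ) ×
                    (∀ x → to σ (to f x) ≡ to g x)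

data BinaryRelation : ℕ → Set where
  R : BinaryRelation 2

binary : Language 0ℓ
binary = record { Function = λ _ → ⊥ ; Relation = BinaryRelation }

relation : (M : Structure binary ℓ) → Rel (Carrier M) ℓ
relation M x y = rel M R (x ∷ y ∷ [])

binaryStructure : (A : Set ℓ) → A → Rel A ℓ → Structure binary ℓ
binaryStructure A x _~_ = record
  { Carrier  = A
  ; nonempty = x
  ; fun      = λ ()
  ; rel      = λ { R (x ∷ y ∷ []) → x ~ y }
  }

ℚ< : Structure binary 0ℓ
ℚ< = binaryStructure ℚ ℚ.0ℚ ℚ._<_

IsInfiniteLinearOrder : Structure binary ℓ → Set ℓ
IsInfiniteLinearOrder O =
  ¬ Finite (Carrier O) × IsStrictTotalOrder _≡_ (relation O)

FiniteGraph : Pred (Structure binary 0ℓ) 0ℓ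
FiniteGraph G =
  Finite (Carrier G) × Symmetric (relation G) × Irreflexive _≡_ (relation G)

FiniteBinaryStructure : Pred (Structure binary 0ℓ) 0ℓ
FiniteBinaryStructure B = Finite (Carrier B)

IsErdosRadoGraph : Pred (Structure binary 0ℓ) (lsuc 0ℓ)
IsErdosRadoGraph = IsFraisseLimit FiniteGraph

IsGenericBinaryRelation : Pred (Structure binary 0ℓ) (lsuc 0ℓ)
IsGenericBinaryRelation = IsFraisseLimit FiniteBinaryStructure

-- Both Unstable and IP say that a formula φ(x, y) induces a given bipartite
-- relation on two families of tuples of a model, and a trace definition of a
-- binary structure (M; E) makes some formula induce E in this way.
--
-- An induced relation can be traded for any other one that it approximates on
-- finite sets, by passing to an ultrapower over a nonprincipal ultrafilter on ℕ:
-- take the limits of the approximating tuples and apply Łoś's theorem. The order of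
-- ℕ approximates that of ℚ (count the fractions of bounded height below a given
-- rational); the finite chains of an infinite linear order approximate the order
-- of ℕ; the finite incidence graphs, which embed in both Fraïssé limits,
-- approximate membership in arbitrary subsets of ℕ. The edges of a countable
-- structure are, directly, a restriction of that membership relation.
--
-- Conversely, if φ induces E on the tuples x a and y b, then a ↦ (x a, y a) is a
-- trace definition as soon as M has quantifier elimination, for then definable
-- sets are Boolean combinations of instances of = and E. Quantifier elimination
-- comes from a back-and-forth: by density for ℚ, by homogeneity for the limits.
module Submission where

open import Defs
open import Axiom.ExcludedMiddle using (ExcludedMiddle)
open import Data.Bool using (Bool; true; false)
open import Data.Empty using (⊥; ⊥-elim)
open import Data.Fin as Fin using (Fin; zero; suc; splitAt; _↑ˡ_; _↑ʳ_; combine)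
open import Data.Fin.Properties as Fin using (injective⇒≤; finToFun-funToFin; toℕ-injective; toℕ-fromℕ<)
open import Data.Integer as ℤ using (+_; -[1+_])
open import Data.List as List using (List; []; _∷_; length; filter; cartesianProduct; cartesianProductWith; allFin; upTo)
open import Data.List.Membership.Propositional using () renaming (_∈_ to _∈ₗ_)
open import Data.List.Membership.Propositional.Properties using (∈-cartesianProduct⁺; ∈-cartesianProductWith⁺; ∈-allFin; ∈-upTo⁺; ∈-++⁺ˡ; ∈-++⁺ʳ; ∈-lookup; ∈-map⁺; ∈-filter⁺)
open import Data.List.Relation.Unary.All as All using (All; []; _∷_)
open import Data.List.Relation.Unary.All.Properties using (++⁺; ++⁻; map⁺; all-filter)
open import Data.List.Relation.Unary.AllPairs using (AllPairs; []; _∷_)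
open import Data.List.Relation.Unary.Any using (here; there; index)
open import Data.List.Relation.Unary.Any.Properties using (lookup-index)
open import Data.Nat as ℕ using (ℕ; zero; suc; _+_; _*_; _^_; _≤_; _<_; _⊔_; z≤n; s≤s)
open import Data.Nat.Properties as ℕ using (≤-refl; ≤-trans; m≤m⊔n; m≤n⊔m)
open import Data.Product using (Σ; ∃; _×_; _,_; proj₁; proj₂; map₂)
open import Data.Rational as ℚ using (ℚ; mkℚ)
import Data.Rational.Properties as ℚ
open import Data.Sum using (_⊎_; inj₁; inj₂; [_,_]′)
open import Data.Unit.Polymorphic using (⊤; tt)
open import Data.Vec as Vec using (Vec; []; _∷_; _++_; lookup; map; concat; head; tail; tabulate)
open import Data.Vec.Properties using (lookup-concat; lookup-map; map-++; tabulate-∘; tabulate-cong; tabulate∘lookup; lookup-splitAt; lookup-++ˡ; lookup-++ʳ; ++-injectiveˡ; ++-injectiveʳ; ∷-injectiveʳ)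
open import Function using (_⇔_; _∘_; id; mk⇔; mk↔ₛ′; Injective; Inverse; Injection)
open import Function.Properties.Inverse using (↔⇒↣; ↔-sym)
open import Function.Bundles using (module Equivalence)
open Equivalence using () renaming (to to ⇒; from to ⇐)
open import Level using (Level; 0ℓ; Lift; lift; lower) renaming (suc to lsuc; _⊔_ to _⊔ˡ_)
open import Relation.Binary using (Rel; REL; IsStrictTotalOrder; Tri; tri<; tri≈; tri>)
open import Relation.Binary.PropositionalEquality using (_≡_; refl; sym; trans; cong; cong₂; subst; subst₂; _≗_; isEquivalence)
open import Relation.Nullary using (¬_; Dec; yes; no)
open import Relation.Nullary.Decidable using (True; toSum; toWitness; fromWitness; decidable-stable)
open import Relation.Unary using (Pred; Satisfiable; _∈_; _∉_; _⊆_; _≐_; _∩_; ∁; Decidable)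

private
  variable
    a b c a′ b′ c′ ℓ ℓ′ : Level

-- Ultrafilters on ℕ and coded relations.

Eventually : Pred ℕ ℓ → Set ℓ
Eventually P = ∃ λ n → ∀ i → n ≤ i → i ∈ P

Frequently : Pred ℕ ℓ → Set ℓ
Frequently P = ∀ n → ∃ λ i → n ≤ i × i ∈ P

-- `large-eventually` puts every cofinite set into the ultrafilter, so it is nonprincipal.
record Ultrafilter ℓ : Set (lsuc ℓ) where
  field
    Large            : Pred (Pred ℕ ℓ) ℓ
    large-mono       : ∀ {P Q} → P ⊆ Q → Large P → Large Q
    large-∩          : ∀ {P Q} → Large P → Large Q → Large (P ∩ Q)
    large-∁          : ∀ {P} → ¬ Large P → Large (∁ P)
    large-eventually : ∀ {P} → Eventually P → Large P
    large-inhabited  : ∀ {P} → Large P → Satisfiable P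

  large-all : ∀ {P} → (∀ i → i ∈ P) → Large P
  large-all p = large-eventually (0 , λ i _ → p i)

  large-∁⁻ : ∀ {P} → Large (∁ P) → ¬ Large P
  large-∁⁻ c l with i , ¬p , p ← large-inhabited (large-∩ c l) = ¬p p

-- Unstable T and IP T are, definitionally, Codes T for < on ℕ and for membership
-- of naturals in subsets of ℕ.
Codes : {L : Language ℓ} (T : Theory L) {A : Set a} {B : Set b} → REL A B c → Set (a ⊔ˡ b ⊔ˡ c ⊔ˡ lsuc ℓ)
Codes {ℓ = ℓ} {L = L} T {A} {B} E =
  ∃ λ p → ∃ λ q → Σ (Formula L (p + q)) λ φ →
  Σ (Structure L ℓ) λ N → Models N (theorems T) ×
  Σ (A → Vec (Carrier N) p) λ x → Σ (B → Vec (Carrier N) q) λ y →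
    ∀ a b → Satisfies N φ (x a ++ y b) ⇔ E a b

-- Renaming of variables and finite conjunctions.

module _ {L : Language a} where

  mutual
    rename-term : ∀ {m n} → (Fin m → Fin n) → Term L m → Term L n
    rename-term ρ (var i) = var (ρ i)
    rename-term ρ (func f ts) = func f (rename-terms ρ ts)

    rename-terms : ∀ {m n k} → (Fin m → Fin n) → Vec (Term L m) k → Vec (Term L n) k
    rename-terms ρ [] = []
    rename-terms ρ (t ∷ ts) = rename-term ρ t ∷ rename-terms ρ ts

  rename : ∀ {m n} → (Fin m → Fin n) → Formula L m → Formula L n
  rename ρ (eq s t) = eq (rename-term ρ s) (rename-term ρ t)
  rename ρ (atom r ts) = atom r (rename-terms ρ ts)
  rename ρ (not φ) = not (rename ρ φ)
  rename ρ (and φ ψ) = and (rename ρ φ) (rename ρ ψ)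
  rename ρ (ex φ) = ex (rename (Fin.lift 1 ρ) φ)

  module _ (N : Structure L ℓ) where

    mutual
      ⟦rename-term⟧ : ∀ {m n} {ρ : Fin m → Fin n} {u v} → lookup v ∘ ρ ≗ lookup u →
                      ∀ t → ⟦ N ⟧ (rename-term ρ t) v ≡ ⟦ N ⟧ t u
      ⟦rename-term⟧ h (var i) = h i
      ⟦rename-term⟧ h (func f ts) = cong (fun N f) (⟦rename-terms⟧ h ts)

      ⟦rename-terms⟧ : ∀ {m n k} {ρ : Fin m → Fin n} {u v} → lookup v ∘ ρ ≗ lookup u →
                       ∀ (ts : Vec (Term L m) k) → ⟦ N ⟧* (rename-terms ρ ts) v ≡ ⟦ N ⟧* ts u
      ⟦rename-terms⟧ h [] = refl
      ⟦rename-terms⟧ h (t ∷ ts) = cong₂ _∷_ (⟦rename-term⟧ h t) (⟦rename-terms⟧ h ts)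

    satisfies-rename : ∀ {m n} (φ : Formula L m) {ρ : Fin m → Fin n} {u v} → lookup v ∘ ρ ≗ lookup u →
                       Satisfies N (rename ρ φ) v ⇔ Satisfies N φ u
    satisfies-rename (eq s t) h = mk⇔ (subst₂ _≡_ (⟦rename-term⟧ h s) (⟦rename-term⟧ h t))
      (subst₂ _≡_ (sym (⟦rename-term⟧ h s)) (sym (⟦rename-term⟧ h t)))
    satisfies-rename (atom r ts) h = mk⇔ (subst (rel N r) (⟦rename-terms⟧ h ts))
      (subst (rel N r) (sym (⟦rename-terms⟧ h ts)))
    satisfies-rename (not φ) h = mk⇔ (_∘ ⇐ (satisfies-rename φ h)) (_∘ ⇒ (satisfies-rename φ h))
    satisfies-rename (and φ ψ) h = mk⇔
      (λ (s , t) → ⇒ (satisfies-rename φ h) s , ⇒ (satisfies-rename ψ h) t)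
      (λ (s , t) → ⇐ (satisfies-rename φ h) s , ⇐ (satisfies-rename ψ h) t)
    satisfies-rename (ex φ) {ρ} {u} {v} h = mk⇔
      (λ (x , s) → x , ⇒ (satisfies-rename φ (under x)) s)
      (λ (x , s) → x , ⇐ (satisfies-rename φ (under x)) s)
      where
      under : ∀ x → lookup (x ∷ v) ∘ Fin.lift 1 ρ ≗ lookup (x ∷ u)
      under x zero = refl
      under x (suc i) = h i

  -- Truth is not among the connectives; this formula is valid because structures are nonempty.
  ⊤ᶠ : ∀ {n} → Formula L n
  ⊤ᶠ = ex (eq (var zero) (var zero))

  conj : ∀ {n} k → (Fin k → Formula L n) → Formula L n
  conj zero _ = ⊤ᶠ
  conj (suc k) φ = and (φ zero) (conj k (φ ∘ suc))

  satisfies-conj : (N : Structure L ℓ) → ∀ {n} k (φ : Fin k → Formula L n) {v} →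
                   Satisfies N (conj k φ) v ⇔ (∀ i → Satisfies N (φ i) v)
  satisfies-conj N zero φ = mk⇔ (λ _ ()) (λ _ → nonempty N , refl)
  satisfies-conj N (suc k) φ = mk⇔
    (λ { (s , _) zero → s ; (_ , t) (suc i) → ⇒ (satisfies-conj N k (φ ∘ suc)) t i })
    (λ s → s zero , ⇐ (satisfies-conj N k (φ ∘ suc)) (s ∘ suc))

-- Listing the renaming as a vector lets it be assembled from blocks of variables, whose values
-- `map-++` computes block by block.
rename-vec : {L : Language a} → ∀ {m n} → Vec (Fin n) m → Formula L m → Formula L n
rename-vec W = rename (lookup W)

satisfies-rename-vec : {L : Language a} (N : Structure L ℓ) → ∀ {m n} (φ : Formula L m) {W : Vec (Fin n) m} {u v} →
                       map (lookup v) W ≡ u → Satisfies N (rename-vec W φ) v ⇔ Satisfies N φ u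
satisfies-rename-vec N φ {W} {v = v} refl = satisfies-rename N φ λ i → sym (lookup-map i (lookup v) W)

map-lookup-tabulate : {A : Set a} → ∀ {m n} {f : Fin m → Fin n} (u : Vec A m) (v : Vec A n) →
                      lookup v ∘ f ≗ lookup u → map (lookup v) (tabulate f) ≡ u
map-lookup-tabulate {f = f} u v h =
  trans (sym (tabulate-∘ (lookup v) f)) (trans (tabulate-cong h) (tabulate∘lookup u))

-- From trace definitions to coded relations.

traceDefines⇒codes : {L : Language ℓ} {T : Theory L} {M : Structure binary ℓ′} →
                     T TraceDefines M → Codes T (relation M)
traceDefines⇒codes {M = M} (N , N⊨T , n , _ , τ , trace)
  with Y , (k , φ , c , Y⇔) , edge ← trace 2 (λ { (x ∷ y ∷ []) → relation M x y })
    (0 , atom R (var zero ∷ var (suc zero) ∷ []) , [] , λ { (_ ∷ _ ∷ []) → mk⇔ id id }) =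
  -- A code has no parameters, so `c` is appended to every tuple on the right-hand side.
  n , n + k , rename-vec ((is ++ (js ++ [])) ++ ks) φ , N , N⊨T , τ , (λ b → τ b ++ c) , λ a b →
    let regroup = satisfies-rename-vec N φ (selected (τ a) (τ b) c)
    in mk⇔ (⇐ (edge (a ∷ b ∷ [])) ∘ ⇐ (Y⇔ _) ∘ ⇒ regroup) (⇐ regroup ∘ ⇒ (Y⇔ _) ∘ ⇒ (edge (a ∷ b ∷ [])))
  where
  -- The three blocks of variables stand for `τ a`, `τ b` and `c`. The `[]` after `js` matches the
  -- empty tail that `concat` leaves behind the second tuple.
  is js : Vec (Fin (n + (n + k))) n
  is = tabulate (_↑ˡ (n + k))
  js = tabulate λ j → n ↑ʳ (j ↑ˡ k)

  ks : Vec (Fin (n + (n + k))) k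
  ks = tabulate λ j → n ↑ʳ (n ↑ʳ j)

  selected : ∀ (u v : Vec (Carrier N) n) w →
             map (lookup (u ++ (v ++ w))) ((is ++ (js ++ [])) ++ ks) ≡ (u ++ (v ++ [])) ++ w
  selected u v w =
    trans (map-++ at (is ++ (js ++ [])) ks) (cong₂ _++_
      (trans (map-++ at is (js ++ [])) (cong₂ _++_
        (map-lookup-tabulate u uvw (lookup-++ˡ u (v ++ w)))
        (trans (map-++ at js []) (cong (_++ [])
          (map-lookup-tabulate v uvw λ j → trans (lookup-++ʳ u (v ++ w) (j ↑ˡ k)) (lookup-++ˡ v w j))))))
      (map-lookup-tabulate w uvw λ j → trans (lookup-++ʳ u (v ++ w) (n ↑ʳ j)) (lookup-++ʳ v w j)))
    where
    uvw : Vec (Carrier N) (n + (n + k))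
    uvw = u ++ (v ++ w)
    at : Fin (n + (n + k)) → Carrier N
    at = lookup uvw

-- Quantifier-free types and back-and-forth.

module _ (M : Structure binary ℓ) where

  -- Equality of quantifier-free types: `binary` has no function symbols, so the only terms are
  -- variables.
  SamePattern : ∀ {p} → Rel (Vec (Carrier M) p) ℓ
  SamePattern u w = ∀ i j →
    (lookup u i ≡ lookup u j ⇔ lookup w i ≡ lookup w j) ×
    (relation M (lookup u i) (lookup u j) ⇔ relation M (lookup w i) (lookup w j))

  -- Only "forth" is written out; "back" is the same condition with `u` and `w` exchanged, by
  -- `SamePattern-sym`.
  BackAndForth : Set ℓ
  BackAndForth = ∀ {p} {u w : Vec (Carrier M) p} → SamePattern u w →
                 ∀ x → ∃ λ y → SamePattern (x ∷ u) (y ∷ w)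

  SamePattern-sym : ∀ {p} {u w : Vec (Carrier M) p} → SamePattern u w → SamePattern w u
  SamePattern-sym same i j = let e , r = same i j in mk⇔ (⇐ e) (⇒ e) , mk⇔ (⇐ r) (⇒ r)

  -- Induction on the formula. One implication suffices, since `u` and `w` are arbitrary and the
  -- case of `not` exchanges them.
  satisfies-pattern : BackAndForth → ∀ {p} (φ : Formula binary p) {u w} →
                      SamePattern u w → Satisfies M φ u → Satisfies M φ w
  satisfies-pattern bf (eq (var i) (var j)) same = ⇒ (proj₁ (same i j))
  satisfies-pattern bf (atom R (var i ∷ var j ∷ [])) same = ⇒ (proj₂ (same i j))
  satisfies-pattern bf (not φ) {u} {w} same ¬s =
    ¬s ∘ satisfies-pattern bf φ (SamePattern-sym {u = u} {w} same)
  satisfies-pattern bf (and φ ψ) same (s , t) = satisfies-pattern bf φ same s , satisfies-pattern bf ψ same t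
  satisfies-pattern bf (ex φ) same (x , s) =
    let y , same′ = bf same x in y , satisfies-pattern bf φ same′ s

tuple-eq : {L : Language a} → ∀ n → Formula L (n + n)
tuple-eq n = conj n λ i → eq (var (i ↑ˡ n)) (var (n ↑ʳ i))

satisfies-tuple-eq : {L : Language a} (N : Structure L ℓ) → ∀ {n} (u w : Vec (Carrier N) n) →
                     Satisfies N (tuple-eq n) (u ++ w) ⇔ u ≡ w
satisfies-tuple-eq N {n} u w = mk⇔
  (λ s → trans (sym (tabulate∘lookup u)) (trans (tabulate-cong λ i →
    trans (sym (lookup-++ˡ u w i)) (trans (⇒ conj⇔ s i) (lookup-++ʳ u w i))) (tabulate∘lookup w)))
  (λ { refl → ⇐ conj⇔ λ i → trans (lookup-++ˡ u u i) (sym (lookup-++ʳ u u i)) })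
  where conj⇔ = satisfies-conj N n _

-- Approximating the order of ℚ by counting fractions.

module _ {A : Set a} {P : Pred A b} {Q : Pred A c} (P? : Decidable P) (Q? : Decidable Q) (P⊆Q : P ⊆ Q) where

  length-filter-mono : ∀ xs → length (filter P? xs) ≤ length (filter Q? xs)
  length-filter-mono [] = z≤n
  length-filter-mono (x ∷ xs) with P? x | Q? x
  ... | yes _ | yes _ = s≤s (length-filter-mono xs)
  ... | yes p | no ¬q = ⊥-elim (¬q (P⊆Q p))
  ... | no _ | yes _ = ℕ.m≤n⇒m≤1+n (length-filter-mono xs)
  ... | no _ | no _ = length-filter-mono xs

  length-filter-strict : ∀ {x xs} → x ∈ₗ xs → ¬ P x → Q x → length (filter P? xs) < length (filter Q? xs)
  length-filter-strict {xs = x ∷ xs} (here refl) ¬p q with P? x | Q? x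
  ... | yes p | _ = ⊥-elim (¬p p)
  ... | no _ | yes _ = s≤s (length-filter-mono xs)
  ... | no _ | no ¬q = ⊥-elim (¬q q)
  length-filter-strict {xs = y ∷ xs} (there x∈) ¬p q with P? y | Q? y
  ... | yes _ | yes _ = s≤s (length-filter-strict x∈ ¬p q)
  ... | yes p | no ¬q = ⊥-elim (¬q (P⊆Q p))
  ... | no _ | yes _ = ℕ.m≤n⇒m≤1+n (length-filter-strict x∈ ¬p q)
  ... | no _ | no _ = length-filter-strict x∈ ¬p q

grid : (ℕ → ℕ → ℚ) → ℕ → List ℚ
grid f n = cartesianProductWith f (upTo n) (upTo n)

grid-exhausts : ∀ f a d → Eventually λ n → f a d ∈ₗ grid f n
grid-exhausts f a d = suc (a ⊔ d) , λ n h → ∈-cartesianProductWith⁺ f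
  (∈-upTo⁺ (≤-trans (s≤s (m≤m⊔n a d)) h)) (∈-upTo⁺ (≤-trans (s≤s (m≤n⊔m a d)) h))

-- The two functions follow the two constructors of ℤ, and the denominator is `suc d` as in `mkℚ`,
-- so every normalised fraction is listed literally.
nonNegFraction negFraction : ℕ → ℕ → ℚ
nonNegFraction a d = + a ℚ./ suc d
negFraction a d = -[1+ a ] ℚ./ suc d

fractions : ℕ → List ℚ
fractions n = grid nonNegFraction n List.++ grid negFraction n

fractions-exhaust : ∀ q → Eventually λ n → q ∈ₗ fractions n
fractions-exhaust q@(mkℚ (+ a) d _) = map₂
  (λ listed n h → ∈-++⁺ˡ (subst (_∈ₗ grid nonNegFraction n) (ℚ.↥p/↧p≡p q) (listed n h)))
  (grid-exhausts nonNegFraction a d)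
fractions-exhaust q@(mkℚ -[1+ a ] d _) = map₂
  (λ listed n h → ∈-++⁺ʳ (grid nonNegFraction n) (subst (_∈ₗ grid negFraction n) (ℚ.↥p/↧p≡p q) (listed n h)))
  (grid-exhausts negFraction a d)

rank : ℕ → ℚ → ℕ
rank n q = length (filter (ℚ._<? q) (fractions n))

-- Every fraction counted for `q` is counted for `r`; once `q` itself is listed, it is counted for
-- `r` only.
rank-mono : ∀ {q r} → q ℚ.< r → Eventually λ n → rank n q < rank n r
rank-mono {q} {r} q<r = map₂ (λ listed n h →
  length-filter-strict (ℚ._<? q) (ℚ._<? r) (λ x<q → ℚ.<-trans x<q q<r) (listed n h) (ℚ.<-irrefl refl) q<r)
  (fractions-exhaust q)

ℚ-greater : ∀ q → ∃ λ r → q ℚ.< r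
ℚ-greater q = q ℚ.+ ℚ.1ℚ , subst (ℚ._< q ℚ.+ ℚ.1ℚ) (ℚ.+-identityʳ q) (ℚ.+-monoʳ-< q (ℚ.positive⁻¹ ℚ.1ℚ))

ℚ-lesser : ∀ q → ∃ λ r → r ℚ.< q
ℚ-lesser q = q ℚ.- ℚ.1ℚ , subst (q ℚ.- ℚ.1ℚ ℚ.<_) (ℚ.+-identityʳ q) (ℚ.+-monoʳ-< q (ℚ.negative⁻¹ (ℚ.- ℚ.1ℚ)))

-- A copy of ℚ in the universe of `T`, where the infinite linear orders of the theorem live.
liftℚ : ∀ ℓ → Structure binary ℓ
liftℚ ℓ = binaryStructure (Lift ℓ ℚ) (lift ℚ.0ℚ) (λ x y → Lift ℓ (lower x ℚ.< lower y))

liftℚ-isStrictTotalOrder : ∀ ℓ → IsStrictTotalOrder _≡_ (relation (liftℚ ℓ))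
liftℚ-isStrictTotalOrder ℓ = record
  { isStrictPartialOrder = record
    { isEquivalence = isEquivalence
    ; irrefl = λ { refl (lift p) → ℚ.<-irrefl refl p }
    ; trans = λ (lift p) (lift q) → lift (ℚ.<-trans p q)
    ; <-resp-≈ = (λ { refl → id }) , (λ { refl → id })
    }
  ; compare = λ x y → lift-tri x y (ℚ.<-cmp (lower x) (lower y))
  }
  where
  lift-tri : ∀ x y → Tri (lower x ℚ.< lower y) (lower x ≡ lower y) (lower y ℚ.< lower x) →
             Tri (relation (liftℚ ℓ) x y) (x ≡ y) (relation (liftℚ ℓ) y x)
  lift-tri x y (tri< p q r) = tri< (lift p) (q ∘ cong lower) (r ∘ lower)
  lift-tri x y (tri≈ p q r) = tri≈ (p ∘ lower) (cong lift q) (r ∘ lower)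
  lift-tri x y (tri> p q r) = tri> (p ∘ lower) (q ∘ cong lower) (lift r)

module Classical (em : ∀ {a} → ExcludedMiddle a) (ac : ∀ {a} → AxiomOfChoice a) where

  dne : {A : Set a} → ¬ ¬ A → A
  dne = decidable-stable em

  -- Excluded middle reduces a proposition to a truth value, which exists in every universe. This
  -- permits the impredicative unions below.
  Resize : ∀ b → Set a → Set b
  Resize b X = Lift b (True (em {P = X}))

  resize : {X : Set a} → X → Resize b X
  resize x = lift (fromWitness x)

  unresize : {X : Set a} → Resize b X → X
  unresize (lift t) = toWitness t

  -- Existence of a nonprincipal ultrafilter, by a Zermelo tower.

  module _ (ℓ : Level) where

    Family : Set (lsuc ℓ)
    Family = Pred (Pred ℕ ℓ) ℓ

    ⋂ : List (Pred ℕ ℓ) → Pred ℕ (lsuc ℓ)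
    ⋂ xs i = All (i ∈_) xs

    -- Asking for infinite rather than inhabited intersections makes a maximal
    -- consistent family a nonprincipal ultrafilter.
    Consistent : Family → Set (lsuc ℓ)
    Consistent f = ∀ xs → All (_∈ f) xs → Frequently (⋂ xs)

    Compatible : Family → Pred (Pred ℕ ℓ) (lsuc ℓ)
    Compatible f s = ∀ xs → All (_∈ f) xs → Frequently (λ i → i ∈ s × i ∈ ⋂ xs)

    New : Family → Pred (Pred ℕ ℓ) (lsuc ℓ)
    New f s = s ∉ f × Compatible f s

    choose : (P : Pred (Pred ℕ ℓ) (lsuc ℓ)) → Satisfiable P → Pred ℕ ℓ
    choose = proj₁ (ac (Pred ℕ ℓ))

    choose-∈ : ∀ P (w : Satisfiable P) → choose P w ∈ P
    choose-∈ = proj₁ (proj₂ (ac (Pred ℕ ℓ)))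

    choose-cong : ∀ {P Q} (w : Satisfiable P) (w′ : Satisfiable Q) → P ≐ Q → choose P w ≡ choose Q w′
    choose-cong = proj₂ (proj₂ (ac (Pred ℕ ℓ))) _ _

    -- At most one set is added: by `choose-cong` the chosen set does not depend on the witness `w`.
    next : Family → Family
    next f s = Resize ℓ (s ∈ f ⊎ Σ (Satisfiable (New f)) λ w → s ≡ choose (New f) w)

    ⊆-next : ∀ {f} → f ⊆ next f
    ⊆-next = resize ∘ inj₁

    New-anti : ∀ {f g} → f ≐ g → New f ⊆ New g
    New-anti (f⊆g , g⊆f) (s∉f , c) = s∉f ∘ g⊆f , λ xs xs⊆g → c xs (All.map g⊆f xs⊆g)

    -- This is where the choice function has to be extensional.
    next-cong : ∀ {f g} → f ≐ g → next f ⊆ next g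
    next-cong {f} {g} (f⊆g , g⊆f) s∈ with unresize s∈
    ... | inj₁ s∈f = ⊆-next (f⊆g s∈f)
    ... | inj₂ (w , refl) = resize (inj₂ (w′ , choose-cong w w′ (f⇒g , New-anti (g⊆f , f⊆g))))
      where
      f⇒g : New f ⊆ New g
      f⇒g = New-anti (f⊆g , g⊆f)
      w′ : Satisfiable (New g)
      w′ = proj₁ w , f⇒g (proj₂ w)

    ⋃ : Pred Family ℓ → Family
    ⋃ 𝒫 s = Resize ℓ (∃ λ f → f ∈ 𝒫 × s ∈ f)

    -- Replaces transfinite iteration of `next`, starting from the empty union; no ordinals are
    -- involved.
    data Tower : Pred Family (lsuc ℓ) where
      step  : ∀ {f} → f ∈ Tower → next f ∈ Tower
      union : ∀ {𝒫} → (∀ {f} → f ∈ 𝒫 → f ∈ Tower) → ⋃ 𝒫 ∈ Tower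

    tower-compare : ∀ {f g} → f ∈ Tower → g ∈ Tower → f ⊆ g ⊎ next g ⊆ f
    tower-compare (step x) y with tower-compare x y
    ... | inj₂ g⁺⊆f = inj₂ (⊆-next ∘ g⁺⊆f)
    ... | inj₁ f⊆g with tower-compare y x
    ...   | inj₂ f⁺⊆g = inj₁ f⁺⊆g
    ...   | inj₁ g⊆f = inj₂ (next-cong (g⊆f , f⊆g))
    tower-compare {g = g} (union {𝒫} x) y with em {P = ∃ λ f → f ∈ 𝒫 × next g ⊆ f}
    ... | yes (f , f∈𝒫 , g⁺⊆f) = inj₂ λ s∈ → resize (f , f∈𝒫 , g⁺⊆f s∈)
    ... | no none = inj₁ λ s∈ → below (unresize s∈)
      where
      below : ∀ {s} → ∃ (λ f → f ∈ 𝒫 × s ∈ f) → s ∈ g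
      below (f , f∈𝒫 , s∈f) with tower-compare (x f∈𝒫) y
      ... | inj₁ f⊆g = f⊆g s∈f
      ... | inj₂ g⁺⊆f = ⊥-elim (none (f , f∈𝒫 , g⁺⊆f))

    -- A list from `next f` consists of members of `f` and copies of the chosen set. Deleting the
    -- copies leaves a list from `f`, to which the compatibility of the chosen set applies.
    next-consistent : ∀ {f} → Consistent f → Consistent (next f)
    next-consistent {f} consistent xs xs∈ with em {P = Satisfiable (New f)}
    ... | yes w = λ n → let ys , ys∈ , imp = old xs xs∈
                            i , n≤i , i∈s , i∈ys = proj₂ (choose-∈ (New f) w) ys ys∈ n
                        in i , n≤i , imp i∈s i∈ys
      where
      old : ∀ xs → All (_∈ next f) xs →
            ∃ λ ys → All (_∈ f) ys × (∀ {i} → i ∈ choose (New f) w → i ∈ ⋂ ys → i ∈ ⋂ xs)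
      old [] [] = [] , [] , λ _ _ → []
      old (x ∷ xs) (x∈ ∷ xs∈) with old xs xs∈ | unresize x∈
      ... | ys , ys∈ , imp | inj₁ x∈f = x ∷ ys , x∈f ∷ ys∈ , λ { i∈s (i∈x ∷ i∈ys) → i∈x ∷ imp i∈s i∈ys }
      ... | ys , ys∈ , imp | inj₂ (w′ , refl) =
        ys , ys∈ , λ {i} i∈s i∈ys → subst (i ∈_) (choose-cong w w′ (id , id)) i∈s ∷ imp i∈s i∈ys
    ... | no ¬w = consistent xs (All.map (λ x∈ → [ id , (λ (w , _) → ⊥-elim (¬w w)) ]′ (unresize x∈)) xs∈)

    -- Consistency has finite character: since the tower is a chain, a nonempty finite list from a
    -- union lies in a single member.
    tower-consistent : ∀ {f} → f ∈ Tower → Consistent f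
    tower-consistent (step x) = next-consistent (tower-consistent x)
    tower-consistent (union {𝒫} x) xs xs∈ with common xs xs∈
      where
      common : ∀ xs → All (_∈ ⋃ 𝒫) xs → xs ≡ [] ⊎ ∃ λ f → f ∈ 𝒫 × All (_∈ f) xs
      common [] [] = inj₁ refl
      common (x₀ ∷ xs) (x₀∈ ∷ xs∈) with unresize x₀∈ | common xs xs∈
      ... | f , f∈ , x₀∈f | inj₁ refl = inj₂ (f , f∈ , x₀∈f ∷ [])
      ... | f , f∈ , x₀∈f | inj₂ (g , g∈ , xs∈g) with tower-compare (x f∈) (x g∈)
      ...   | inj₁ f⊆g = inj₂ (g , g∈ , f⊆g x₀∈f ∷ xs∈g)
      ...   | inj₂ g⁺⊆f = inj₂ (f , f∈ , x₀∈f ∷ All.map (λ s∈g → g⁺⊆f (⊆-next s∈g)) xs∈g)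
    ... | inj₁ refl = λ n → n , ≤-refl , []
    ... | inj₂ (f , f∈𝒫 , xs∈f) = tower-consistent (x f∈𝒫) xs xs∈f

    -- The union of the whole tower belongs to the tower, so it is a fixed point of `next`.
    top : Family
    top = ⋃ (λ f → Resize ℓ (f ∈ Tower))

    top∈Tower : top ∈ Tower
    top∈Tower = union unresize

    next-top : next top ⊆ top
    next-top s∈ = resize (next top , resize (step top∈Tower) , s∈)

    -- If some compatible set were missing, `next` would add a set outside `top`, against
    -- `next-top`.
    top-maximal : ∀ {s} → Compatible top s → s ∈ top
    top-maximal {s} c = dne λ s∉ →
      let w = s , s∉ , c
      in proj₁ (choose-∈ (New top) w) (next-top (resize (inj₂ (w , refl))))

    top-consistent : Consistent top
    top-consistent = tower-consistent top∈Tower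

    top-mono : ∀ {xs t} → All (_∈ top) xs → (∀ {i} → i ∈ ⋂ xs → i ∈ t) → t ∈ top
    top-mono {xs} xs∈ xs⊆t = top-maximal λ ys ys∈ n →
      let i , n≤i , i∈ = top-consistent (xs List.++ ys) (++⁺ xs∈ ys∈) n
          i∈xs , i∈ys = ++⁻ xs i∈
      in i , n≤i , xs⊆t i∈xs , i∈ys

    -- If `∁ s` is incompatible, some finite intersection `⋂ ys` lies in `s` from `m` on. Then `s`
    -- meets every finite intersection `⋂ xs` infinitely often, because `⋂ (xs ++ ys)` is infinite.
    top-∁ : ∀ {s} → s ∉ top → ∁ s ∈ top
    top-∁ {s} s∉ = top-maximal λ ys ys∈ m → dne λ none →
      s∉ (top-maximal λ xs xs∈ n →
        let i , n⊔m≤i , i∈ = top-consistent (xs List.++ ys) (++⁺ xs∈ ys∈) (n ⊔ m)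
            i∈xs , i∈ys = ++⁻ xs i∈
        in i , ≤-trans (m≤m⊔n n m) n⊔m≤i
         , dne (λ i∉s → none (i , ≤-trans (m≤n⊔m n m) n⊔m≤i , i∉s , i∈ys))
         , i∈xs)

    ultrafilter : Ultrafilter ℓ
    ultrafilter = record
      { Large            = top
      ; large-mono       = λ P⊆Q P∈ → top-mono (P∈ ∷ []) λ { (i∈P ∷ []) → P⊆Q i∈P }
      ; large-∩          = λ P∈ Q∈ → top-mono (P∈ ∷ Q∈ ∷ []) λ { (i∈P ∷ i∈Q ∷ []) → i∈P , i∈Q }
      ; large-∁          = top-∁
      ; large-eventually = λ (m , P) → top-maximal λ xs xs∈ n →
          let i , n⊔m≤i , i∈xs = top-consistent xs xs∈ (n ⊔ m)
          in i , ≤-trans (m≤m⊔n n m) n⊔m≤i , P i (≤-trans (m≤n⊔m n m) n⊔m≤i) , i∈xs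
      ; large-inhabited  = λ {P} P∈ →
          let i , _ , i∈ = top-consistent (P ∷ []) (P∈ ∷ []) 0 in i , All.head i∈
      }

  -- Ultrapowers and Łoś's theorem.

  module _ {L : Language a} (N : Structure L ℓ) where
    open Ultrafilter (ultrafilter ℓ)

    infix 4 _≈_
    _≈_ : Rel (ℕ → Carrier N) ℓ
    f ≈ g = Large λ i → f i ≡ g i

    ≈-sym : ∀ {f g} → f ≈ g → g ≈ f
    ≈-sym = large-mono sym

    ≈-trans : ∀ {f g h} → f ≈ g → g ≈ h → f ≈ h
    ≈-trans p q = large-mono (λ (x , y) → trans x y) (large-∩ p q)

    class : ∀ f → Satisfiable (f ≈_)
    class f = f , large-all λ _ → refl

    norm : (ℕ → Carrier N) → ℕ → Carrier N
    norm f = proj₁ (ac (ℕ → Carrier N)) (f ≈_) (class f)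

    ≈-norm : ∀ f → f ≈ norm f
    ≈-norm f = proj₁ (proj₂ (ac (ℕ → Carrier N))) (f ≈_) (class f)

    -- Equivalent sequences have classes of the same extension, from which an extensional choice
    -- function picks the same element.
    norm-cong : ∀ {f g} → f ≈ g → norm f ≡ norm g
    norm-cong {f} {g} f≈g = proj₂ (proj₂ (ac (ℕ → Carrier N))) _ _ (class f) (class g)
      (≈-trans (≈-sym f≈g) , ≈-trans f≈g)

    -- Structures interpret equality by _≡_ and Agda has no quotients, so the
    -- elements of the ultrapower are chosen representatives.
    Ultra : Set ℓ
    Ultra = ∃ λ f → norm f ≡ f

    at : ℕ → Ultra → Carrier N
    at i (f , _) = f i

    [_] : (ℕ → Carrier N) → Ultra
    [ f ] = norm f , norm-cong (≈-sym (≈-norm f))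

    at-[] : ∀ f → Large λ i → at i [ f ] ≡ f i
    at-[] f = ≈-sym (≈-norm f)

    Ultra-ext : ∀ x y → Large (λ i → at i x ≡ at i y) → x ≡ y
    Ultra-ext (f , p) (g , q) f≈g = pair (trans (sym p) (trans (norm-cong f≈g) q)) p q
      where
      pair : ∀ {f g} → f ≡ g → (p : norm f ≡ f) (q : norm g ≡ g) → (f , p) ≡ (g , q)
      pair {f} refl p q = cong (f ,_) (uip p q)
        where
        uip : ∀ {x y : ℕ → Carrier N} (p q : x ≡ y) → p ≡ q
        uip refl refl = refl

    ultrapower : Structure L ℓ
    ultrapower = record
      { Carrier  = Ultra
      ; nonempty = [ (λ _ → nonempty N) ]
      ; fun      = λ f v → [ (λ i → fun N f (map (at i) v)) ]
      ; rel      = λ r v → Large λ i → rel N r (map (at i) v)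
      }

    mutual
      łoś-term : ∀ {n} (t : Term L n) v →
                 Large λ i → at i (⟦ ultrapower ⟧ t v) ≡ ⟦ N ⟧ t (map (at i) v)
      łoś-term (var k) v = large-all λ i → sym (lookup-map k (at i) v)
      łoś-term (func f ts) v = large-mono (λ (p , q) → trans p (cong (fun N f) q))
        (large-∩ (at-[] _) (łoś-terms ts v))

      łoś-terms : ∀ {n k} (ts : Vec (Term L n) k) v →
                  Large λ i → map (at i) (⟦ ultrapower ⟧* ts v) ≡ ⟦ N ⟧* ts (map (at i) v)
      łoś-terms [] v = large-all λ _ → refl
      łoś-terms (t ∷ ts) v = large-mono (λ (p , q) → cong₂ _∷_ p q)
        (large-∩ (łoś-term t v) (łoś-terms ts v))

    -- The case of `not` is where the filter has to be ultra; the case of `ex` chooses witnesses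
    -- coordinate by coordinate.
    łoś : ∀ {n} (φ : Formula L n) v →
          Satisfies ultrapower φ v ⇔ Large λ i → Satisfies N φ (map (at i) v)
    łoś (eq s t) v = mk⇔
      (λ e → large-mono (λ {i} (p , q) → trans (sym p) (trans (cong (at i) e) q)) terms)
      (λ l → Ultra-ext _ _ (large-mono (λ ((p , q) , e) → trans p (trans e (sym q))) (large-∩ terms l)))
      where terms = large-∩ (łoś-term s v) (łoś-term t v)
    łoś (atom r ts) v = mk⇔
      (λ l → large-mono (λ (e , x) → subst (rel N r) e x) (large-∩ (łoś-terms ts v) l))
      (λ l → large-mono (λ (e , x) → subst (rel N r) (sym e) x) (large-∩ (łoś-terms ts v) l))
    łoś (not φ) v = mk⇔
      (λ ¬s → large-∁ (¬s ∘ ⇐ (łoś φ v)))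
      (λ l → large-∁⁻ l ∘ ⇒ (łoś φ v))
    łoś (and φ ψ) v = mk⇔
      (λ (s , t) → large-∩ (⇒ (łoś φ v) s) (⇒ (łoś ψ v) t))
      (λ l → ⇐ (łoś φ v) (large-mono proj₁ l) , ⇐ (łoś ψ v) (large-mono proj₂ l))
    łoś (ex φ) v = mk⇔
      (λ (x , s) → large-mono (λ {i} t → at i x , t) (⇒ (łoś φ (x ∷ v)) s))
      (λ l → [ f ] , ⇐ (łoś φ ([ f ] ∷ v))
        (large-mono (λ {i} (e , s) → subst (λ x → Satisfies N φ (x ∷ map (at i) v)) (sym e) (f-witness s))
          (large-∩ (at-[] f) l)))
      where
      -- The default value occurs only at coordinates without a witness, and these lie outside a
      -- large set.
      f : ℕ → Carrier N
      f i with em {P = ∃ λ x → Satisfies N φ (x ∷ map (at i) v)}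
      ... | yes (x , _) = x
      ... | no _ = nonempty N
      f-witness : ∀ {i} → ∃ (λ x → Satisfies N φ (x ∷ map (at i) v)) → Satisfies N φ (f i ∷ map (at i) v)
      f-witness {i} s with em {P = ∃ λ x → Satisfies N φ (x ∷ map (at i) v)}
      ... | yes (_ , t) = t
      ... | no none = ⊥-elim (none s)

    ultrapower-models : {Γ : Pred (Sentence L) b} → Models N Γ → Models ultrapower Γ
    ultrapower-models N⊨ σ σ∈ = ⇐ (łoś σ []) (large-all λ _ → N⊨ σ σ∈)

    limit : ∀ {p} → (ℕ → Vec (Carrier N) p) → Vec Ultra p
    limit {zero} _ = []
    limit {suc p} v = [ head ∘ v ] ∷ limit (tail ∘ v)

    at-limit : ∀ {p} (v : ℕ → Vec (Carrier N) p) → Large λ i → map (at i) (limit v) ≡ v i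
    at-limit {zero} v = large-all λ i → empty (v i)
      where
      empty : (w : Vec (Carrier N) 0) → [] ≡ w
      empty [] = refl
    at-limit {suc p} v = large-mono (λ {i} (e , es) → cons (v i) e es)
      (large-∩ (at-[] _) (at-limit (tail ∘ v)))
      where
      cons : ∀ {x xs} (w : Vec (Carrier N) (suc p)) → x ≡ head w → xs ≡ tail w → x ∷ xs ≡ w
      cons (_ ∷ _) refl refl = refl

    limit-satisfies : ∀ {p q} (φ : Formula L (p + q)) (v : ℕ → Vec (Carrier N) p) (w : ℕ → Vec (Carrier N) q) →
      Satisfies ultrapower φ (limit v ++ limit w) ⇔ Large λ i → Satisfies N φ (v i ++ w i)
    limit-satisfies φ v w = mk⇔
      (λ s → large-mono (λ (e , x) → subst (Satisfies N φ) e x) (large-∩ both (⇒ (łoś φ (limit v ++ limit w)) s)))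
      (λ l → ⇐ (łoś φ (limit v ++ limit w)) (large-mono (λ (e , x) → subst (Satisfies N φ) (sym e) x) (large-∩ both l)))
      where
      both : Large λ i → map (at i) (limit v ++ limit w) ≡ v i ++ w i
      both = large-mono (λ {i} (e , e′) → trans (map-++ (at i) (limit v) (limit w)) (cong₂ _++_ e e′))
        (large-∩ (at-limit v) (at-limit w))

  -- Eventual truth and eventual falsity are both decided by the ultrafilter, so Łoś's theorem
  -- carries edges and non-edges to the limits of the approximating tuples.
  codes-limit : {L : Language ℓ} {T : Theory L} {A : Set a} {B : Set b} {A′ : Set a′} {B′ : Set b′}
                {E : REL A B c} {E′ : REL A′ B′ c′} (f : ℕ → A′ → A) (g : ℕ → B′ → B) →
                (∀ {x y} → E′ x y → Eventually λ i → E (f i x) (g i y)) →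
                (∀ {x y} → ¬ E′ x y → Eventually λ i → ¬ E (f i x) (g i y)) →
                Codes T E → Codes T E′
  codes-limit {ℓ = ℓ} f g pos neg (p , q , φ , N , N⊨T , x , y , code) =
    p , q , φ , ultrapower N , ultrapower-models N N⊨T ,
    limit N ∘ x̂ , limit N ∘ ŷ , λ a b →
      mk⇔ (λ s → dne λ ¬e → let m , never = neg ¬e in
             large-∁⁻ (large-eventually (m , λ i m≤i → never i m≤i ∘ ⇒ (code _ _)))
                      (⇒ (limit-satisfies N φ (x̂ a) (ŷ b)) s))
          (λ e → let m , always = pos e in
             ⇐ (limit-satisfies N φ (x̂ a) (ŷ b))
               (large-eventually (m , λ i m≤i → ⇐ (code _ _) (always i m≤i))))
    where
    open Ultrafilter (ultrafilter ℓ)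
    x̂ = λ a i → x (f i a)
    ŷ = λ b i → y (g i b)

  -- From coded relations to trace definitions.

  module _ {V : Set a} {L : Language b} (N : Structure L ℓ) {r} (g : V → Vec (Carrier N) r) where

    DefinableAlong : Pred V c → Set _
    DefinableAlong Z = Σ (Formula L r) λ φ → ∀ v → v ∈ Z ⇔ Satisfies N φ (g v)

    -- X is split along the first predicate; each half depends only on the others.
    definable-determined : {I : Set} (xs : List I) (P : I → Pred V a) → (∀ i → DefinableAlong (P i)) →
      (X : Pred V a) → (∀ {v w} → All (λ i → v ∈ P i ⇔ w ∈ P i) xs → v ∈ X → w ∈ X) → DefinableAlong X
    definable-determined [] P _ X det with em {P = Satisfiable X}
    ... | yes (_ , x) = ⊤ᶠ , λ v → mk⇔ (λ _ → nonempty N , refl) (λ _ → det [] x)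
    ... | no none = not ⊤ᶠ , λ v → mk⇔ (λ x → ⊥-elim (none (v , x))) (λ ¬⊤ → ⊥-elim (¬⊤ (nonempty N , refl)))
    definable-determined (i ∷ xs) P def X det =
      -- This is `ψ → φ⁺` together with `¬ ψ → φ⁻`, written with `and` and `not`.
      and (not (and ψ (not φ⁺))) (not (and (not ψ) (not φ⁻))) , λ v → mk⇔
        (λ v∈X →
          (λ (s , ¬t) → ¬t (⇒ (φ⁺⇔ v) (v , v∈X , ⇐ (ψ⇔ v) s , refl-Same))) ,
          (λ (¬s , ¬t) → ¬t (⇒ (φ⁻⇔ v) (v , v∈X , ¬s ∘ ⇒ (ψ⇔ v) , refl-Same))))
        (λ (s , t) → [ (λ v∈P → let w , w∈X , w∈P , same = dne {A = part (P i) v} (λ no → s (⇒ (ψ⇔ v) v∈P , no ∘ ⇐ (φ⁺⇔ v)))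
                                in det (mk⇔ (λ _ → v∈P) (λ _ → w∈P) ∷ same) w∈X)
                     , (λ v∉P → let w , w∈X , w∉P , same = dne {A = part (∁ (P i)) v} (λ no → t (v∉P ∘ ⇐ (ψ⇔ v) , no ∘ ⇐ (φ⁻⇔ v)))
                                in det (mk⇔ (⊥-elim ∘ w∉P) (⊥-elim ∘ v∉P) ∷ same) w∈X)
                     ]′ (toSum em))
      where
      Same : V → V → Set a
      Same v w = All (λ j → v ∈ P j ⇔ w ∈ P j) xs
      trans-Same : ∀ {u v w} → Same u v → Same v w → Same u w
      trans-Same p q = All.zipWith (λ (x , y) → mk⇔ (⇒ y ∘ ⇒ x) (⇐ x ∘ ⇐ y)) (p , q)
      -- Saturating `X ∩ Q` under agreement on `xs` gives a set determined by `xs` alone, to which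
      -- the induction applies.
      part : Pred V a → Pred V a
      part Q v = ∃ λ w → w ∈ X × w ∈ Q × Same w v
      def-part : ∀ Q → DefinableAlong (part Q)
      def-part Q = definable-determined xs P def (part Q)
        λ same (w , w∈X , w∈Q , w∼v) → w , w∈X , w∈Q , trans-Same w∼v same
      refl-Same : ∀ {v} → Same v v
      refl-Same = All.universal (λ _ → mk⇔ id id) xs
      ψ = proj₁ (def i)
      ψ⇔ = proj₂ (def i)
      φ⁺ = proj₁ (def-part (P i))
      φ⁺⇔ = proj₂ (def-part (P i))
      φ⁻ = proj₁ (def-part (∁ (P i)))
      φ⁻⇔ = proj₂ (def-part (∁ (P i)))

  module _ (M : Structure binary ℓ) (bf : BackAndForth M) {L : Language a} (N : Structure L ℓ′)
           {n} (τ : Carrier M → Vec (Carrier N) n) (τ-injective : Injective _≡_ _≡_ τ)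
           (θ : Formula L (n + n)) (edge : ∀ x y → Satisfies N θ (τ x ++ τ y) ⇔ relation M x y) where

    -- By `satisfies-pattern`, membership in `X` depends only on the atomic relations among the
    -- entries of `v ++ c`. Each of these is definable from the images under `τ`: equality because
    -- `τ` is injective, edges by `θ`.
    isTraceDefinition : IsTraceDefinition M N τ
    isTraceDefinition m X (k , φ , c , X⇔) =
      (λ w → Satisfies N χ (w ++ concat (map τ c))) ,
      (k * n , χ , concat (map τ c) , λ _ → mk⇔ id id) ,
      χ⇔
      where
      g : Vec (Carrier M) m → Vec (Carrier N) (m * n + k * n)
      g v = concat (map τ v) ++ concat (map τ c)

      position : Fin m ⊎ Fin k → Fin n → Fin (m * n + k * n)
      position (inj₁ i) s = combine i s ↑ˡ (k * n)
      position (inj₂ j) s = (m * n) ↑ʳ combine j s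

      lookup-position : ∀ v x s → lookup (g v) (position x s) ≡ lookup (τ ([ lookup v , lookup c ]′ x)) s
      lookup-position v (inj₁ i) s = trans (lookup-++ˡ (concat (map τ v)) _ _)
        (trans (lookup-concat (map τ v) i s) (cong (λ t → lookup t s) (lookup-map i τ v)))
      lookup-position v (inj₂ j) s = trans (lookup-++ʳ (concat (map τ v)) _ _)
        (trans (lookup-concat (map τ c) j s) (cong (λ t → lookup t s) (lookup-map j τ c)))

      block : Fin (m + k) → Vec (Fin (m * n + k * n)) n
      block i = tabulate (position (splitAt m i))

      lookup-block : ∀ v i → map (lookup (g v)) (block i) ≡ τ (lookup (v ++ c) i)
      lookup-block v i = map-lookup-tabulate (τ (lookup (v ++ c) i)) (g v) λ s →
        trans (lookup-position v (splitAt m i) s)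
              (cong (λ x → lookup (τ x) s) (sym (lookup-splitAt m v c i)))

      lookup-blocks : ∀ v i j → map (lookup (g v)) (block i ++ block j) ≡ τ (lookup (v ++ c) i) ++ τ (lookup (v ++ c) j)
      lookup-blocks v i j = trans (map-++ (lookup (g v)) (block i) (block j))
        (cong₂ _++_ (lookup-block v i) (lookup-block v j))

      Atomic : Bool × Fin (m + k) × Fin (m + k) → Pred (Vec (Carrier M) m) ℓ
      Atomic (true , i , j) v = lookup (v ++ c) i ≡ lookup (v ++ c) j
      Atomic (false , i , j) v = relation M (lookup (v ++ c) i) (lookup (v ++ c) j)

      atomic-definable : ∀ x → DefinableAlong N g (Atomic x)
      atomic-definable (true , i , j) = rename-vec (block i ++ block j) (tuple-eq n) , λ v →
        let renamed = satisfies-rename-vec N (tuple-eq n) (lookup-blocks v i j)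
            equal = satisfies-tuple-eq N (τ (lookup (v ++ c) i)) (τ (lookup (v ++ c) j))
        in mk⇔ (⇐ renamed ∘ ⇐ equal ∘ cong τ) (τ-injective ∘ ⇒ equal ∘ ⇒ renamed)
      atomic-definable (false , i , j) = rename-vec (block i ++ block j) θ , λ v →
        let renamed = satisfies-rename-vec N θ (lookup-blocks v i j)
        in mk⇔ (⇐ renamed ∘ ⇐ (edge _ _)) (⇒ (edge _ _) ∘ ⇒ renamed)

      atoms : List (Bool × Fin (m + k) × Fin (m + k))
      atoms = cartesianProduct (true ∷ false ∷ []) (cartesianProduct (allFin (m + k)) (allFin (m + k)))

      atoms-complete : ∀ b i j → (b , i , j) ∈ₗ atoms
      atoms-complete b i j = ∈-cartesianProduct⁺ (bool b) (∈-cartesianProduct⁺ (∈-allFin i) (∈-allFin j))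
        where
        bool : ∀ b → b ∈ₗ true ∷ false ∷ []
        bool true = here refl
        bool false = there (here refl)

      determined : ∀ {v w} → All (λ x → v ∈ Atomic x ⇔ w ∈ Atomic x) atoms → v ∈ X → w ∈ X
      determined {v} {w} same = ⇐ (X⇔ w) ∘ satisfies-pattern M bf φ
        (λ i j → All.lookup same (atoms-complete true i j) , All.lookup same (atoms-complete false i j)) ∘ ⇒ (X⇔ v)

      X-definable : DefinableAlong N g X
      X-definable = definable-determined N g atoms Atomic atomic-definable X determined

      χ = proj₁ X-definable
      χ⇔ = proj₂ X-definable

  -- The last hypothesis makes `τ` injective, so that equality in `M` becomes equality of tuples.
  codes⇒traceDefines : {L : Language ℓ} {T : Theory L} {M : Structure binary ℓ′} → BackAndForth M →
    ((_ , _ , _ , _ , _ , x , y , _) : Codes T (relation M)) →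
    (∀ {a b} → x a ≡ x b → y a ≡ y b → a ≡ b) → T TraceDefines M
  codes⇒traceDefines {M = M} bf (p , q , φ , N , N⊨T , x , y , code) separates =
    N , N⊨T , suc (p + q) , _ , τ ,
    isTraceDefinition M bf N τ τ-injective (rename-vec W φ) λ a b →
      let renamed = satisfies-rename-vec N φ (selected a b)
      in mk⇔ (⇒ (code a b) ∘ ⇒ renamed) (⇐ renamed ∘ ⇐ (code a b))
    where
    -- The constant first coordinate only serves to make the arity nonzero.
    τ : Carrier M → Vec (Carrier N) (suc (p + q))
    τ a = nonempty N ∷ (x a ++ y a)

    τ-injective : Injective _≡_ _≡_ τ
    τ-injective {a} {b} e = separates (++-injectiveˡ (x a) (x b) (∷-injectiveʳ e))
                                      (++-injectiveʳ (x a) (x b) (∷-injectiveʳ e))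

    left : Fin p → Fin (suc (p + q) + suc (p + q))
    left i = suc (i ↑ˡ q) ↑ˡ suc (p + q)

    right : Fin q → Fin (suc (p + q) + suc (p + q))
    right j = suc (p + q) ↑ʳ suc (p ↑ʳ j)

    W : Vec (Fin (suc (p + q) + suc (p + q))) (p + q)
    W = tabulate left ++ tabulate right

    selected : ∀ a b → map (lookup (τ a ++ τ b)) W ≡ x a ++ y b
    selected a b = trans (map-++ (lookup (τ a ++ τ b)) (tabulate left) (tabulate right)) (cong₂ _++_
      (map-lookup-tabulate (x a) (τ a ++ τ b) λ i →
        trans (lookup-++ˡ (τ a) (τ b) (suc (i ↑ˡ q))) (lookup-++ˡ (x a) (y a) i))
      (map-lookup-tabulate (y b) (τ a ++ τ b) λ j →
        trans (lookup-++ʳ (τ a) (τ b) (suc (p ↑ʳ j))) (lookup-++ʳ (x b) (y b) j)))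

  -- Finite chains in linear orders.

  module LinearOrder (O : Structure binary ℓ) (isSTO : IsStrictTotalOrder _≡_ (relation O)) where
    open IsStrictTotalOrder isSTO using (compare) renaming (trans to <ᵒ-trans; irrefl to <ᵒ-irrefl; asym to <ᵒ-asym)

    infix 4 _<ᵒ_
    _<ᵒ_ : Rel (Carrier O) ℓ
    _<ᵒ_ = relation O

    -- The last clause serves the induction: it keeps an earlier head below the list after the
    -- insertion.
    insert : ∀ x {xs} → AllPairs _<ᵒ_ xs → ¬ x ∈ₗ xs →
             ∃ λ ys → length ys ≡ suc (length xs) × AllPairs _<ᵒ_ ys ×
               (∀ {z} → z <ᵒ x → All (z <ᵒ_) xs → All (z <ᵒ_) ys)
    insert x [] _ = x ∷ [] , refl , [] ∷ [] , λ z<x _ → z<x ∷ []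
    insert x {y ∷ xs} (y< ∷ sorted) x∉ with compare x y
    ... | tri< x<y _ _ = x ∷ y ∷ xs , refl , (x<y ∷ All.map (<ᵒ-trans x<y) y<) ∷ y< ∷ sorted , _∷_
    ... | tri≈ _ x≡y _ = ⊥-elim (x∉ (here x≡y))
    ... | tri> _ _ y<x with ys , len , sorted′ , bound ← insert x sorted (x∉ ∘ there) =
      y ∷ ys , cong suc len , bound y<x y< ∷ sorted′ , λ { z<x (z<y ∷ z<xs) → z<y ∷ bound z<x z<xs }

    lookup-mono : ∀ {xs} → AllPairs _<ᵒ_ xs → ∀ {i j} → i Fin.< j → List.lookup xs i <ᵒ List.lookup xs j
    lookup-mono {_ ∷ xs} (y< ∷ sorted) {zero} {suc j} _ = All.lookup y< (∈-lookup j)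
    lookup-mono (_ ∷ sorted) {suc i} {suc j} (s≤s i<j) = lookup-mono sorted i<j

    lookup-injective : ∀ {xs} → AllPairs _<ᵒ_ xs → ∀ {i j} → List.lookup xs i ≡ List.lookup xs j → i ≡ j
    lookup-injective sorted {i} {j} e with Fin.<-cmp i j
    ... | tri< i<j _ _ = ⊥-elim (<ᵒ-irrefl e (lookup-mono sorted i<j))
    ... | tri≈ _ i≡j _ = i≡j
    ... | tri> _ _ j<i = ⊥-elim (<ᵒ-irrefl (sym e) (lookup-mono sorted j<i))

    -- If `a <ᵒ b` and `x a ≡ x b`, the code of `a <ᵒ b` also codes `b <ᵒ b`; symmetrically for
    -- `b <ᵒ a`.
    codes-separate : {L : Language ℓ′} {T : Theory L} ((_ , _ , _ , _ , _ , x , _) : Codes T _<ᵒ_) →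
                     ∀ {a b} → x a ≡ x b → a ≡ b
    codes-separate (_ , _ , φ , N , _ , x , y , code) {a} {b} e with compare a b
    ... | tri< a<b _ _ = ⊥-elim (<ᵒ-irrefl refl
      (⇒ (code b b) (subst (λ t → Satisfies N φ (t ++ y b)) e (⇐ (code a b) a<b))))
    ... | tri≈ _ a≡b _ = a≡b
    ... | tri> _ _ b<a = ⊥-elim (<ᵒ-irrefl refl
      (⇒ (code a a) (subst (λ t → Satisfies N φ (t ++ y a)) (sym e) (⇐ (code b a) b<a))))

    entry : List (Carrier O) → ℕ → Carrier O
    entry xs i with i ℕ.<? length xs
    ... | yes i<n = List.lookup xs (Fin.fromℕ< i<n)
    ... | no _ = nonempty O

    entry-mono : ∀ {xs} → AllPairs _<ᵒ_ xs → ∀ {i j} → i < j → j < length xs → entry xs i <ᵒ entry xs j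
    entry-mono {xs} sorted {i} {j} i<j j<n with i ℕ.<? length xs | j ℕ.<? length xs
    ... | yes i<n | yes j<n′ = lookup-mono sorted (subst₂ _<_ (sym (toℕ-fromℕ< i<n)) (sym (toℕ-fromℕ< j<n′)) i<j)
    ... | no i≮n | _ = ⊥-elim (i≮n (ℕ.<-trans i<j j<n))
    ... | yes _ | no j≮n = ⊥-elim (j≮n j<n)

    module _ (infinite : ¬ Finite (Carrier O)) where

      -- A sorted list has no repetitions, so if it contained everything its indices would enumerate
      -- the carrier bijectively.
      missing : ∀ {xs} → AllPairs _<ᵒ_ xs → ∃ λ x → ¬ x ∈ₗ xs
      missing {xs} sorted = dne λ none →
        let all : ∀ x → x ∈ₗ xs
            all x = dne λ x∉ → none (x , x∉)
        in infinite (length xs , mk↔ₛ′ (λ x → index (all x)) (List.lookup xs)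
             (λ i → lookup-injective sorted (sym (lookup-index (all (List.lookup xs i)))))
             (λ x → sym (lookup-index (all x))))

      chain : ∀ n → ∃ λ xs → length xs ≡ n × AllPairs _<ᵒ_ xs
      chain zero = [] , refl , []
      chain (suc n) =
        let xs , len , sorted = chain n
            x , x∉ = missing sorted
            ys , len′ , sorted′ , _ = insert x sorted x∉
        in ys , trans len′ (cong suc len) , sorted′

      approx : ℕ → ℕ → Carrier O
      approx n = entry (proj₁ (chain n))

      approx-mono : ∀ {n i j} → i < j → j < n → approx n i <ᵒ approx n j
      approx-mono {n} i<j j<n = let _ , len , sorted = chain n in
        entry-mono sorted i<j (subst (_ <_) (sym len) j<n)

      codes⇒unstable : {L : Language ℓ′} {T : Theory L} → Codes T _<ᵒ_ → Unstable T
      -- Beyond `j`, the chain of length `n` is long enough to have both `i` and `j` as positions.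
      codes⇒unstable {T = T} = codes-limit {T = T} approx approx (λ {i} {j} i<j → suc j , λ n j<n → approx-mono i<j j<n) neg
        where
        neg : ∀ {i j} → ¬ i < j → Eventually λ n → ¬ approx n i <ᵒ approx n j
        neg {i} {j} i≮j with ℕ.<-cmp i j
        ... | tri< i<j _ _ = ⊥-elim (i≮j i<j)
        ... | tri≈ _ refl _ = 0 , λ _ _ → <ᵒ-irrefl refl
        ... | tri> _ _ j<i = suc i , λ n i<n → <ᵒ-asym (approx-mono j<i i<n)

      traceDefines⇒unstable : {L : Language ℓ′} {T : Theory L} → T TraceDefines O → Unstable T
      traceDefines⇒unstable {T = T} traced = codes⇒unstable {T = T} (traceDefines⇒codes {T = T} traced)

    -- Dense linear orders without endpoints.

    module _ (dense : ∀ {x y} → x <ᵒ y → ∃ λ z → x <ᵒ z × z <ᵒ y)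
             (lesser : ∀ x → ∃ λ y → y <ᵒ x) (greater : ∀ x → ∃ λ y → x <ᵒ y) where

      -- Iterating `greater` gives a strictly increasing sequence, which would inject `Fin (suc n)`
      -- into `Fin n`.
      infinite : ¬ Finite (Carrier O)
      infinite (n , A↔Fin) = ℕ.<⇒≱ (ℕ.n<1+n n) (injective⇒≤ {f = Inverse.to A↔Fin ∘ s ∘ Fin.toℕ}
        (toℕ-injective ∘ s-injective ∘ Injection.injective (↔⇒↣ A↔Fin)))
        where
        s : ℕ → Carrier O
        s zero = nonempty O
        s (suc k) = proj₁ (greater (s k))
        s-mono : ∀ {i j} → i ℕ.<′ j → s i <ᵒ s j
        s-mono {i} (ℕ.<′-base) = proj₂ (greater (s i))
        s-mono {i} (ℕ.≤′-step i<j) = <ᵒ-trans (s-mono i<j) (proj₂ (greater _))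
        s-injective : ∀ {i j} → s i ≡ s j → i ≡ j
        s-injective {i} {j} e with ℕ.<-cmp i j
        ... | tri< i<j _ _ = ⊥-elim (<ᵒ-irrefl e (s-mono (ℕ.<⇒<′ i<j)))
        ... | tri≈ _ i≡j _ = i≡j
        ... | tri> _ _ j<i = ⊥-elim (<ᵒ-irrefl (sym e) (s-mono (ℕ.<⇒<′ j<i)))

      -- Finds the minimum of finitely many witnesses. `P` is either trivial or a lower bound
      -- `a <ᵒ_`.
      below-all : (P : Pred (Carrier O) ℓ) → Satisfiable P → ∀ bs →
                  All (λ b → ∃ λ y → y ∈ P × y <ᵒ b) bs → ∃ λ y → y ∈ P × All (y <ᵒ_) bs
      below-all P (y , y∈P) [] [] = y , y∈P , []
      below-all P sat (b ∷ bs) ((z , z∈P , z<b) ∷ bounds) with y , y∈P , y<bs ← below-all P sat bs bounds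
        with compare y b
      ... | tri< y<b _ _ = y , y∈P , y<b ∷ y<bs
      ... | tri≈ _ refl _ = z , z∈P , z<b ∷ All.map (<ᵒ-trans z<b) y<bs
      ... | tri> _ _ b<y = z , z∈P , z<b ∷ All.map (<ᵒ-trans (<ᵒ-trans z<b b<y)) y<bs

      -- Start below all of `bs`; whenever some `a` is not below the current point, move the point
      -- up into the gap between `a` and `bs`.
      between : ∀ as bs → All (λ a → All (a <ᵒ_) bs) as → ∃ λ y → All (_<ᵒ y) as × All (y <ᵒ_) bs
      between [] bs [] with y , _ , y<bs ← below-all (λ _ → ⊤) (nonempty O , tt) bs
        (All.universal (λ b → proj₁ (lesser b) , tt , proj₂ (lesser b)) bs) = y , [] , y<bs
      between (a ∷ as) bs (a<bs ∷ as<bs) with y , as<y , y<bs ← between as bs as<bs with compare a y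
      ... | tri< a<y _ _ = y , a<y ∷ as<y , y<bs
      ... | tri≈ _ refl _ with z , a<z , z<bs ← below-all (a <ᵒ_) (greater a) bs (All.map dense a<bs) =
        z , a<z ∷ All.map (λ x<y → <ᵒ-trans x<y a<z) as<y , z<bs
      ... | tri> _ _ y<a with z , a<z , z<bs ← below-all (a <ᵒ_) (greater a) bs (All.map dense a<bs) =
        z , a<z ∷ All.map (λ x<y → <ᵒ-trans x<y (<ᵒ-trans y<a a<z)) as<y , z<bs

      -- By trichotomy, one constructor settles all the equivalences that `SamePattern` demands of a
      -- pair.
      data SameOrder (x y x′ y′ : Carrier O) : Set ℓ where
        lt : x <ᵒ y → x′ <ᵒ y′ → SameOrder x y x′ y′
        eq : x ≡ y → x′ ≡ y′ → SameOrder x y x′ y′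
        gt : y <ᵒ x → y′ <ᵒ x′ → SameOrder x y x′ y′

      SameOrder-sym : ∀ {x y x′ y′} → SameOrder x y x′ y′ → SameOrder y x y′ x′
      SameOrder-sym (lt p q) = gt p q
      SameOrder-sym (eq p q) = eq (sym p) (sym q)
      SameOrder-sym (gt p q) = lt p q

      SameOrder⇒ : ∀ {x y x′ y′} → SameOrder x y x′ y′ → (x ≡ y ⇔ x′ ≡ y′) × (x <ᵒ y ⇔ x′ <ᵒ y′)
      SameOrder⇒ (lt p q) = mk⇔ (λ e → ⊥-elim (<ᵒ-irrefl e p)) (λ e → ⊥-elim (<ᵒ-irrefl e q)) , mk⇔ (λ _ → q) (λ _ → p)
      SameOrder⇒ (eq p q) = mk⇔ (λ _ → q) (λ _ → p) , mk⇔ (λ l → ⊥-elim (<ᵒ-irrefl p l)) (λ l → ⊥-elim (<ᵒ-irrefl q l))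
      SameOrder⇒ (gt p q) = mk⇔ (λ e → ⊥-elim (<ᵒ-irrefl (sym e) p)) (λ e → ⊥-elim (<ᵒ-irrefl (sym e) q)) ,
                            mk⇔ (λ l → ⊥-elim (<ᵒ-asym l p)) (λ l → ⊥-elim (<ᵒ-asym l q))

      ⇒SameOrder : ∀ {p} {u w : Vec (Carrier O) p} → SamePattern O u w →
                   ∀ i j → SameOrder (lookup u i) (lookup u j) (lookup w i) (lookup w j)
      ⇒SameOrder {u = u} same i j with compare (lookup u i) (lookup u j)
      ... | tri< l _ _ = lt l (⇒ (proj₂ (same i j)) l)
      ... | tri≈ _ e _ = eq e (⇒ (proj₁ (same i j)) e)
      ... | tri> _ _ g = gt g (⇒ (proj₂ (same j i)) g)

      -- Cantor's argument: a new `x` cuts the entries of `u` into a left and a right part, and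
      -- density provides a point in the corresponding cut of `w`.
      backAndForth : BackAndForth O
      backAndForth {p} {u} {w} same x = let y , position = place in y , extend position
        where
        extend : ∀ {y} → (∀ i → SameOrder (lookup u i) x (lookup w i) y) → SamePattern O (x ∷ u) (y ∷ w)
        extend pos zero zero = SameOrder⇒ (eq refl refl)
        extend pos zero (suc j) = SameOrder⇒ (SameOrder-sym (pos j))
        extend pos (suc i) zero = SameOrder⇒ (pos i)
        extend pos (suc i) (suc j) = same i j

        left? : ∀ i → Dec (lookup u i <ᵒ x)
        left? i = em
        right? : ∀ i → Dec (x <ᵒ lookup u i)
        right? i = em

        as bs : List (Carrier O)
        as = List.map (lookup w) (filter left? (allFin p))
        bs = List.map (lookup w) (filter right? (allFin p))

        as<bs : All (λ a → All (a <ᵒ_) bs) as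
        as<bs = map⁺ (All.map (λ l → map⁺ (All.map (λ r → ⇒ (proj₂ (same _ _)) (<ᵒ-trans l r))
          (all-filter right? (allFin p)))) (all-filter left? (allFin p)))

        place : ∃ λ y → ∀ i → SameOrder (lookup u i) x (lookup w i) y
        place with em {P = ∃ λ i → lookup u i ≡ x}
        ... | yes (i , refl) = lookup w i , λ j → ⇒SameOrder {u = u} {w} same j i
        ... | no new with y , as<y , y<bs ← between as bs as<bs = y , position
          where
          position : ∀ i → SameOrder (lookup u i) x (lookup w i) y
          position i with compare (lookup u i) x
          ... | tri< l _ _ = lt l (All.lookup as<y (∈-map⁺ (lookup w) (∈-filter⁺ left? (∈-allFin i) l)))
          ... | tri≈ _ e _ = ⊥-elim (new (i , e))
          ... | tri> _ _ g = gt g (All.lookup y<bs (∈-map⁺ (lookup w) (∈-filter⁺ right? (∈-allFin i) g)))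

      unstable⇒traceDefines : (f : ℕ → Carrier O → ℕ) → (∀ {x y} → x <ᵒ y → Eventually λ n → f n x < f n y) →
                              {L : Language ℓ′} {T : Theory L} → Unstable T → T TraceDefines O
      unstable⇒traceDefines f f-mono {T = T} unstable =
        codes⇒traceDefines {T = T} backAndForth codes λ e _ → codes-separate {T = T} codes e
        where
        neg : ∀ {x y} → ¬ x <ᵒ y → Eventually λ n → ¬ f n x < f n y
        neg {x} {y} x≮y with compare x y
        ... | tri< x<y _ _ = ⊥-elim (x≮y x<y)
        ... | tri≈ _ refl _ = 0 , λ _ _ → ℕ.<-irrefl refl
        ... | tri> _ _ y<x = map₂ (λ h n n≤ → ℕ.<-asym (h n n≤)) (f-mono y<x)

        codes = codes-limit {T = T} f f f-mono neg unstable

  -- Instability and infinite linear orders.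

  private module ℚᵒ = LinearOrder ℚ< ℚ.<-isStrictTotalOrder

  unstable⇔ℚ : {L : Language ℓ} (T : Theory L) → Unstable T ⇔ T TraceDefines ℚ<
  unstable⇔ℚ T = mk⇔
    (ℚᵒ.unstable⇒traceDefines ℚ.<-dense ℚ-lesser ℚ-greater rank rank-mono {T = T})
    (ℚᵒ.traceDefines⇒unstable (ℚᵒ.infinite ℚ.<-dense ℚ-lesser ℚ-greater) {T = T})

  unstable⇔infiniteOrder : {L : Language ℓ} (T : Theory L) →
    Unstable T ⇔ Σ (Structure binary ℓ) λ O → IsInfiniteLinearOrder O × T TraceDefines O
  unstable⇔infiniteOrder {ℓ} T = mk⇔
    (λ unstable → liftℚ ℓ
      , (Q.infinite dense lesser greater , liftℚ-isStrictTotalOrder ℓ)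
      , Q.unstable⇒traceDefines dense lesser greater (λ n → rank n ∘ lower) (rank-mono ∘ lower) {T = T} unstable)
    (λ (O , (infinite , isSTO) , traced) → LinearOrder.traceDefines⇒unstable O isSTO infinite {T = T} traced)
    where
    module Q = LinearOrder (liftℚ ℓ) (liftℚ-isStrictTotalOrder ℓ)
    dense : ∀ {x y} → relation (liftℚ ℓ) x y → ∃ λ z → relation (liftℚ ℓ) x z × relation (liftℚ ℓ) z y
    dense (lift p) = let z , x<z , z<y = ℚ.<-dense p in lift z , lift x<z , lift z<y
    lesser : ∀ x → ∃ λ y → relation (liftℚ ℓ) y x
    lesser (lift x) = let y , y<x = ℚ-lesser x in lift y , lift y<x
    greater : ∀ x → ∃ λ y → relation (liftℚ ℓ) x y
    greater (lift x) = let y , x<y = ℚ-greater x in lift y , lift x<y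

  -- Fraïssé limits and the independence property.

  distinct-entries : {A : Set a} → ∀ {p} (u : Fin p → A) →
    ∃ λ r → Σ (Fin r → Fin p) λ σ → Σ (Fin p → Fin r) λ ρ →
      (∀ i → u (σ (ρ i)) ≡ u i) × Injective _≡_ _≡_ (u ∘ σ)
  distinct-entries {p = zero} u = 0 , (λ ()) , (λ ()) , (λ ()) , λ {}
  distinct-entries {p = suc p} u with distinct-entries (u ∘ suc)
  ... | r , σ , ρ , section , inj with em {P = ∃ λ k → u (suc (σ k)) ≡ u zero}
  ...   | yes (k , e) = r , suc ∘ σ , (λ { zero → k ; (suc i) → ρ i }) ,
          (λ { zero → e ; (suc i) → section i }) , inj
  ...   | no new = suc r , σ′ , (λ { zero → zero ; (suc i) → suc (ρ i) }) ,
          (λ { zero → refl ; (suc i) → section i }) , inj′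
    where
    σ′ : Fin (suc r) → Fin (suc p)
    σ′ zero = zero
    σ′ (suc k) = suc (σ k)
    inj′ : Injective _≡_ _≡_ (u ∘ σ′)
    inj′ {zero} {zero} _ = refl
    inj′ {zero} {suc k} e = ⊥-elim (new (k , sym e))
    inj′ {suc j} {zero} e = ⊥-elim (new (j , e))
    inj′ {suc j} {suc k} e = cong suc (inj e)

  module _ {K : Pred (Structure binary 0ℓ) 0ℓ} {G : Structure binary 0ℓ} (isLimit : IsFraisseLimit K G) where
    open IsFraisseLimit isLimit

    relational-embedding : {A : Set} {x : A} {E : Rel A 0ℓ} (f : A → Carrier G) → Injective _≡_ _≡_ f →
      (∀ x y → E x y ⇔ relation G (f x) (f y)) → Embedding (binaryStructure A x E) G
    relational-embedding f inj pres = record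
      { to = f ; injective = inj ; onFun = λ () ; onRel = λ { R (x ∷ y ∷ []) → pres x y } }

    -- Embeddings are injective, so homogeneity is applied to the substructure on the distinct
    -- entries of `u`, which embeds through `u` and through `w`.
    extends : ∀ {p} {u w : Vec (Carrier G) p} → SamePattern G u w →
              Σ (Embedding G G) λ α → ∀ i → to α (lookup u i) ≡ lookup w i
    -- Structures are nonempty, so the empty tuple gives no substructure; the identity serves
    -- instead.
    extends {zero} _ = record { to = id ; injective = id ; onFun = λ () ; onRel = λ { R (_ ∷ _ ∷ []) → mk⇔ id id } } , λ ()
    extends {suc p} {u} {w} same with r , σ , ρ , section , inj ← distinct-entries (lookup u)
      with α , _ , α-extends ← homogeneous
        (binaryStructure (Fin r) (ρ zero) (λ j k → relation G (lookup u (σ j)) (lookup u (σ k))))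
        (r , mk↔ₛ′ id id (λ _ → refl) (λ _ → refl))
        (relational-embedding (lookup u ∘ σ) inj (λ _ _ → mk⇔ id id))
        (relational-embedding (lookup w ∘ σ) (λ {j} {k} → inj ∘ ⇐ (proj₁ (same (σ j) (σ k))))
          (λ j k → proj₂ (same (σ j) (σ k))))
      = α , λ i → trans (cong (to α) (sym (section i)))
                        (trans (α-extends (ρ i)) (⇒ (proj₁ (same (σ (ρ i)) i)) (section i)))

    fraïssé-backAndForth : BackAndForth G
    fraïssé-backAndForth {p} {u} {w} same x with α , αu≡w ← extends {u = u} {w} same = to α x , preserved
      where
      image : ∀ i → to α (lookup (x ∷ u) i) ≡ lookup (to α x ∷ w) i
      image zero = refl
      image (suc i) = αu≡w i

      preserved : SamePattern G (x ∷ u) (to α x ∷ w)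
      preserved i j rewrite sym (image i) | sym (image j) = mk⇔ (cong (to α)) (injective α) , onRel α R _

    ip⇒traceDefines : {L : Language ℓ} {T : Theory L} → IP T → T TraceDefines G
    ip⇒traceDefines {T = T} (p , q , φ , N , N⊨T , x , y , code) =
      codes⇒traceDefines {T = T} fraïssé-backAndForth
        (p , q , φ , N , N⊨T , x ∘ ix , y ∘ neighbours , λ a b → mk⇔
          (λ s → let c , e , cEb = ⇒ (code (ix a) (neighbours b)) s in subst (λ c → relation G c b) (ix-injective e) cEb)
          (λ aEb → ⇐ (code (ix a) (neighbours b)) (a , refl , aEb)))
        -- The singleton of `ix b` separates: if the tuples agree, `ix a` belongs to it as well.
        λ {a} {b} e _ → ix-injective (⇒ (code (ix a) (_≡ ix b))
          (subst (λ t → Satisfies N φ (t ++ y (_≡ ix b))) (sym e) (⇐ (code (ix b) (_≡ ix b)) refl)))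
      where
      ix : Carrier G → ℕ
      ix = Injection.to countable

      ix-injective : ∀ {a b} → ix a ≡ ix b → a ≡ b
      ix-injective = Injection.injective countable

      neighbours : Carrier G → Pred ℕ 0ℓ
      neighbours b i = ∃ λ c → ix c ≡ i × relation G c b

  -- The vertices of the second kind code the subsets of Fin n in binary.
  incidence : ∀ n → Rel (Fin n ⊎ Fin (2 ^ n)) 0ℓ
  incidence n (inj₁ i) (inj₂ s) = Fin.finToFun {2} {n} s i ≡ suc zero
  incidence n (inj₂ s) (inj₁ i) = Fin.finToFun {2} {n} s i ≡ suc zero
  incidence n _ _ = ⊥

  indicator : {A : Set} → Dec A → Fin 2
  indicator (yes _) = suc zero
  indicator (no _) = zero

  indicator⇔ : {A : Set} (a? : Dec A) → indicator a? ≡ suc zero ⇔ A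
  indicator⇔ (yes a) = mk⇔ (λ _ → a) (λ _ → refl)
  indicator⇔ (no ¬a) = mk⇔ (λ ()) (⊥-elim ∘ ¬a)

  -- Only the part of `I` below `n` is recorded, with membership decided by excluded middle.
  code-subset : ∀ n → Pred ℕ 0ℓ → Fin (2 ^ n)
  code-subset n I = Fin.funToFin {n} {2} λ k → indicator (em {P = Fin.toℕ k ∈ I})

  incidence-code : ∀ {n} i I → incidence n (inj₁ i) (inj₂ (code-subset n I)) ⇔ Fin.toℕ i ∈ I
  incidence-code {n} i I = subst (λ c → c ≡ suc zero ⇔ Fin.toℕ i ∈ I)
    (sym (finToFun-funToFin {n} {2} (λ k → indicator (em {P = Fin.toℕ k ∈ I})) i)) (indicator⇔ em)

  incidenceGraph : ℕ → Structure binary 0ℓ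
  incidenceGraph n = binaryStructure (Fin n ⊎ Fin (2 ^ n)) (inj₂ (code-subset n (λ _ → ⊥))) (incidence n)

  incidenceGraph-finite : ∀ n → Finite (Carrier (incidenceGraph n))
  incidenceGraph-finite n = n + 2 ^ n , ↔-sym Fin.+↔⊎

  incidenceGraph-graph : ∀ n → incidenceGraph n ∈ FiniteGraph
  incidenceGraph-graph n = incidenceGraph-finite n ,
    (λ { {inj₁ _} {inj₂ _} e → e ; {inj₂ _} {inj₁ _} e → e }) ,
    λ { {inj₁ _} refl () ; {inj₂ _} refl () }

  traceDefines⇒ip : {G : Structure binary 0ℓ} → (∀ n → Embedding (incidenceGraph n) G) →
                    {L : Language ℓ} {T : Theory L} → T TraceDefines G → IP T
  traceDefines⇒ip {G = G} embed {T = T} traced =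
    codes-limit {T = T} element set
      (λ {i} {I} i∈I → suc i , λ n i<n → ⇐ (edge n i I i<n) i∈I)
      (λ {i} {I} i∉I → suc i , λ n i<n → i∉I ∘ ⇒ (edge n i I i<n))
      (traceDefines⇒codes {T = T} traced)
    where
    element : ℕ → ℕ → Carrier G
    element n i with i ℕ.<? n
    ... | yes i<n = to (embed n) (inj₁ (Fin.fromℕ< i<n))
    -- A default value for the finitely many `n` with `n ≤ i`, which the limit ignores.
    ... | no _ = nonempty G

    set : ℕ → Pred ℕ 0ℓ → Carrier G
    set n I = to (embed n) (inj₂ (code-subset n I))

    edge : ∀ n i (I : Pred ℕ 0ℓ) → i < n → relation G (element n i) (set n I) ⇔ i ∈ I
    edge n i I i<n with i ℕ.<? n
    ... | no i≮n = ⊥-elim (i≮n i<n)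
    ... | yes i<n′ = subst (λ j → relation G (to (embed n) (inj₁ k)) (set n I) ⇔ j ∈ I) (toℕ-fromℕ< i<n′)
      (mk⇔ (⇒ (incidence-code k I) ∘ ⇐ (onRel (embed n) R (inj₁ k ∷ inj₂ (code-subset n I) ∷ [])))
           (⇒ (onRel (embed n) R (inj₁ k ∷ inj₂ (code-subset n I) ∷ [])) ∘ ⇐ (incidence-code k I)))
      where k = Fin.fromℕ< i<n′

  -- The age of `G` is `K`, so every incidence graph embeds in `G`. Both classes of the theorem
  -- contain these graphs.
  ip⇔fraïssé : {K : Pred (Structure binary 0ℓ) 0ℓ} {G : Structure binary 0ℓ} → IsFraisseLimit K G →
               (∀ n → incidenceGraph n ∈ K) → {L : Language ℓ} (T : Theory L) → IP T ⇔ T TraceDefines G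
  ip⇔fraïssé isLimit graphs∈K T = mk⇔ (ip⇒traceDefines isLimit {T = T})
    (traceDefines⇒ip (λ n → proj₂ (⇒ (IsFraisseLimit.age isLimit (incidenceGraph n)) (graphs∈K n))) {T = T})

theoremA : (∀ {a} → ExcludedMiddle a) → (∀ {a} → AxiomOfChoice a) →
    ∀ {ℓ : Level} {L : Language ℓ} (T : Theory L) →
    ( (Unstable T ⇔ T TraceDefines ℚ<)
    × (Unstable T ⇔ Σ (Structure binary ℓ) λ O → IsInfiniteLinearOrder O × T TraceDefines O) )
    × ( ∀ (G : Structure binary 0ℓ) → IsErdosRadoGraph G →
    ∀ (H : Structure binary 0ℓ) → IsGenericBinaryRelation H →
    (IP T ⇔ T TraceDefines G) × (IP T ⇔ T TraceDefines H) )
theoremA em ac T =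
  (unstable⇔ℚ T , unstable⇔infiniteOrder T) , λ G isER H isGeneric →
    ip⇔fraïssé isER incidenceGraph-graph T , ip⇔fraïssé isGeneric incidenceGraph-finite T
  where open Classical em ac
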